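{- Let $\Delta\ge0$ be an integer, let $0<\epsilon\le\frac12$, and let $n\ge\frac{5\Delta}{\epsilon^2}$ be an integer. If $T$ is a reflexive tree of maximum degree at most $\Delta$ and $\sigma$ is a voltage assignment on $T$ into $\mathbb{Z}_n$ that assigns to each loop a group element coprime to $n$, then $T^\sigma$ contains a cycle with at least $(1-\epsilon)|V(T^\sigma)|$ vertices.
   Context: A reflexive tree is a tree with exactly one loop at each vertex; its degree refers to the number of non-loop edges at a vertex. A voltage assignment is a map $\sigma$ from the arcs of $T$ (each edge $[u,v]$ gives arcs $(u,v),(v,u)$; each loop gives two arcs) to $\mathbb{Z}_n$ with $\sigma(v,u)=-\sigma(u,v)$ and the two loop arcs receiving opposite values. The lift $T^\sigma$ has vertex set $V(T)\times\mathbb{Z}_n$, with $(u,a)\sim(v,b)$ iff some arc $(u,v)$ has $\sigma(u,v)=b-a$.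
   Formalization: The number ε is taken to be rational rather than real; the real case follows by choosing a rational ε′ slightly larger than ε, since the number of vertices of a cycle is an integer. -}

module Defs where

open import Data.Bool using (Bool; true; false)
open import Data.Nat as ℕ using (ℕ; suc; _%_)
open import Data.Fin using (Fin; toℕ)
open import Data.List using (List; length; filterᵇ; allFin)
open import Data.Product using (_×_; _,_; ∃; Σ)
open import Data.Sum using (_⊎_)
open import Data.Integer as ℤ using (ℤ; +_; _-_; _+_; ∣_∣)
open import Data.Integer.Divisibility as ℤDiv using ()
open import Data.Nat.Coprimality using (Coprime)
open import Relation.Binary.PropositionalEquality using (_≡_)
open import Relation.Binary.Construct.Closure.ReflexiveTransitive using (Star)
open import Function.Definitions using (Injective)

IsCycle : {V : Set} → (V → V → Set) → (k : ℕ) → (Fin (suc k) → V) → Set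
IsCycle R k c =
  Injective _≡_ _≡_ c ×
  (∀ (i j : Fin (suc k)) → suc (toℕ i) % suc k ≡ toℕ j → R (c i) (c j))

-- Reflexive trees on vertex set Fin m.
-- `adj` records the NON-loop edges (simple graph); every vertex carries
-- exactly one loop implicitly.

SimpleAdj : (m : ℕ) → (Fin m → Fin m → Bool) → Fin m → Fin m → Set
SimpleAdj m adj u v = adj u v ≡ true

IsSimpleGraph : (m : ℕ) → (Fin m → Fin m → Bool) → Set
IsSimpleGraph m adj =
  (∀ u v → adj u v ≡ adj v u) × (∀ u → adj u u ≡ false)

IsTree : (m : ℕ) → (Fin m → Fin m → Bool) → Set
IsTree m adj =
  1 ℕ.≤ m ×
  IsSimpleGraph m adj ×
  (∀ u v → Star (SimpleAdj m adj) u v) ×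
  (∀ k (c : Fin (suc k) → Fin m) → 2 ℕ.≤ k → IsCycle (SimpleAdj m adj) k c → Data.Empty.⊥)
  where import Data.Empty

-- degree = number of non-loop neighbours
degree : (m : ℕ) → (Fin m → Fin m → Bool) → Fin m → ℕ
degree m adj v = length (filterᵇ (adj v) (allFin m))

MaxDegreeAtMost : (m : ℕ) → (Fin m → Fin m → Bool) → ℕ → Set
MaxDegreeAtMost m adj Δ = ∀ v → degree m adj v ℕ.≤ Δ

-- Voltage assignments into ℤ_n.  Elements of ℤ_n are represented by
-- integers, equality in ℤ_n being congruence mod n.

_≡[mod_]_ : ℤ → ℕ → ℤ → Set
x ≡[mod n ] y = (+ n) ℤDiv.∣ (x - y)

-- σ u v : voltage of arc (u,v) (relevant only when adj u v ≡ true);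
-- ℓ u : voltage of one of the two arcs of the loop at u (the other arc
-- receives - ℓ u).
IsVoltage : (m n : ℕ) → (Fin m → Fin m → Bool) → (Fin m → Fin m → ℤ) → Set
IsVoltage m n adj σ = ∀ u v → adj u v ≡ true → (σ v u) ≡[mod n ] (ℤ.- σ u v)

LiftAdj : (m n : ℕ) → (Fin m → Fin m → Bool) → (Fin m → Fin m → ℤ) → (Fin m → ℤ) →
          Fin m × Fin n → Fin m × Fin n → Set
LiftAdj m n adj σ ℓ (u , a) (v , b) =
  (adj u v ≡ true × (+ toℕ b - + toℕ a) ≡[mod n ] σ u v) ⊎
  (u ≡ v × ((+ toℕ b - + toℕ a) ≡[mod n ] ℓ u ⊎ (+ toℕ b - + toℕ a) ≡[mod n ] (ℤ.- ℓ u)))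

{-# OPTIONS --safe #-}
-- Above each vertex u the lift contains an n-cycle generated by the loop voltage ℓ u.
-- Starting from one such fibre, attach the others one at a time along an edge uv with u
-- already covered.  Dirichlet's argument gives 1 ≤ t ≤ Q and |e| ≤ n / Q with
-- t ℓ(u) = e ℓ(v) in ℤ_n, so the arc of t steps in the fibre of u can be exchanged for a
-- detour around the fibre of v that misses fewer than n / Q points.  Each attachment costs at
-- most n / Q + Q vertices, and a fresh fibre has a free arc long enough for the at most Δ
-- arcs that are cut from it later.  For Q ≈ 2 / ε the cost is at most ε n.
module Submission where

open import Defs
open import Data.Nat as ℕ using (ℕ; zero; suc; NonZero; z≤n; s≤s)
import Data.Nat.Properties as ℕₚ
open import Data.Nat.DivMod using (_/_; _%_; m≡m%n+[m/n]*n; m%n<n; m<n⇒m%n≡m; n%n≡0; m<n*o⇒m/o<n; m/n*n≤m)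
import Data.Nat.Divisibility as ℕDiv
open import Data.Nat.Coprimality as Coprimality using (Coprime; coprime-Bézout; coprime-divisor)
open import Data.Nat.GCD using (module Bézout)
open import Data.Nat.Tactic.RingSolver using () renaming (solve-∀ to ℕ-solve-∀)
open import Data.Bool using (Bool; true; false)
open import Data.Bool.Properties using (T?; T-≡)
open import Data.Fin using (Fin; zero; suc; toℕ; fromℕ<)
import Data.Fin.Properties as Finₚ
open import Data.Integer as ℤ using (ℤ; +_; -[1+_]; +[1+_]; ∣_∣; _+_; _-_; _*_; -_; +≤+; +<+)
import Data.Integer.Properties as ℤₚ
open import Data.Integer.Divisibility.Signed using (_∣_; divides; ∣ᵤ⇒∣; ∣⇒∣ᵤ; ∣m∣n⇒∣m+n; ∣m⇒∣-m; ∣n⇒∣m*n)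
open import Data.Integer.DivMod using (_%ℕ_; _/ℕ_; n%ℕd<d; a≡a%ℕn+[a/ℕn]*n)
open import Data.Integer.Tactic.RingSolver using (solve-∀)
open import Data.Rational as ℚ using (ℚ; mkℚ; toℚᵘ; 0ℚ; 1ℚ; ½)
import Data.Rational.Properties as ℚₚ
open import Data.Rational.Unnormalised as ℚᵘ using (mkℚᵘ; *≤*)
import Data.Rational.Unnormalised.Properties as ℚᵘₚ
open import Data.List using (List; []; _∷_; [_]; _++_; length; lookup; filterᵇ; tabulate)
open import Data.List.Properties using (∷-injective; ++-assoc; ++-identityʳ; length-++; length-tabulate)
open import Data.List.Membership.Propositional using (_∈_; _∉_)
open import Data.List.Membership.Propositional.Properties using (∈-lookup; ∈-∃++; ∈-length; ∈-filter⁺; ∈-allFin; ∈-tabulate⁺)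
open import Data.List.Relation.Unary.All as All using (All; []; _∷_)
import Data.List.Relation.Unary.All.Properties as Allₚ
open import Data.List.Relation.Unary.Any using (here; there)
open import Data.List.Relation.Unary.AllPairs using ([]; _∷_)
import Data.List.Relation.Unary.AllPairs.Properties as AllPairsₚ
open import Data.List.Relation.Unary.Unique.Propositional using (Unique)
open import Data.List.Relation.Unary.Unique.Propositional.Properties using (allFin⁺)
open import Data.List.Relation.Binary.Permutation.Propositional using (_↭_; ↭-sym; ↭⇒↭ₛ)
open import Data.List.Relation.Binary.Permutation.Propositional.Properties using (shift; shifts; ↭-length; filter-↭; ∈-resp-↭)
import Data.List.Relation.Binary.Permutation.Setoid.Properties as ↭ₛ
open import Data.Product using (_×_; _,_; Σ; ∃; ∃₂; proj₁; proj₂)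
open import Data.Sum using (_⊎_; inj₁; inj₂; [_,_]′)
open import Data.Empty using (⊥-elim)
open import Function using (_∘_; Equivalence)
open import Relation.Binary.Construct.Closure.ReflexiveTransitive using (Star; _◅_) renaming (ε to done)
open import Relation.Nullary using (¬_; yes; no; contradiction)
open import Relation.Binary.PropositionalEquality using (_≡_; _≢_; refl; sym; trans; cong; cong₂; subst; subst₂; setoid)

private
  variable
    V : Set
    R : V → V → Set
    P : V → Set

-- Walks listed by their vertices, and the cycles they close up to.

data Walk {V : Set} (R : V → V → Set) : V → List V → V → Set where
  single : ∀ x → Walk R x [ x ] x
  step   : ∀ {x y z ys} → R x y → Walk R y ys z → Walk R x (x ∷ ys) z

walk-++ : ∀ {x y z w : V} {xs ys} → Walk R x xs y → R y z → Walk R z ys w → Walk R x (xs ++ ys) w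
walk-++ (single _) r w′ = step r w′
walk-++ (step r₀ w) r w′ = step r₀ (walk-++ w r w′)

walk-suffix : ∀ xs {x y z : V} {ys} → Walk R x (xs ++ y ∷ ys) z → Walk R y (y ∷ ys) z
walk-suffix []           (single _) = single _
walk-suffix []           (step r w) = step r w
walk-suffix (_ ∷ [])     (step _ w) = walk-suffix [] w
walk-suffix (_ ∷ x ∷ xs) (step _ w) = walk-suffix (x ∷ xs) w

-- The walk up to `a` and from `b` onwards is kept, so only the two edges joining the detour `C` to
-- it need checking.
walk-replace : ∀ pre {x z a b c d : V} A {C post} → R a c → Walk R c C d → R d b →
               Walk R x (pre ++ a ∷ A ++ b ∷ post) z → Walk R x (pre ++ a ∷ C ++ b ∷ post) z
walk-replace []            []      r w r′ (step r₀ w₀) = step r (walk-++ w r′ (walk-suffix [] w₀))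
walk-replace []            (x ∷ A) r w r′ (step r₀ w₀) = step r (walk-++ w r′ (walk-suffix (x ∷ A) w₀))
walk-replace (_ ∷ [])      A       r w r′ (step r₀ w₀) = step r₀ (walk-replace [] A r w r′ w₀)
walk-replace (_ ∷ p ∷ pre) A       r w r′ (step r₀ w₀) = step r₀ (walk-replace (p ∷ pre) A r w r′ w₀)

lookup-first : ∀ {x z : V} {xs} → Walk R x xs z → (i : Fin (length xs)) → toℕ i ≡ 0 → lookup xs i ≡ x
lookup-first (single _) zero _ = refl
lookup-first (step _ _) zero _ = refl

lookup-last : ∀ {x z : V} {xs} → Walk R x xs z → (i : Fin (length xs)) →
              suc (toℕ i) ≡ length xs → lookup xs i ≡ z
lookup-last (single _)            zero    _  = refl
lookup-last (step _ (single _))   zero    ()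
lookup-last (step _ (step _ _))   zero    ()
lookup-last (step _ w)            (suc i) eq = lookup-last w i (ℕₚ.suc-injective eq)

lookup-step : ∀ {x z : V} {xs} → Walk R x xs z → (i j : Fin (length xs)) →
              suc (toℕ i) ≡ toℕ j → R (lookup xs i) (lookup xs j)
lookup-step {R = R} (step r w) zero (suc j) eq =
  subst (R _) (sym (lookup-first w j (sym (ℕₚ.suc-injective eq)))) r
lookup-step (step r w) (suc i) (suc j) eq = lookup-step w i j (ℕₚ.suc-injective eq)
lookup-step (single _) _ zero ()

lookup-injective : ∀ {xs : List V} → Unique xs → ∀ {i j} → lookup xs i ≡ lookup xs j → i ≡ j
lookup-injective (_ ∷ _)  {zero}  {zero}  _  = refl
lookup-injective (px ∷ _) {zero}  {suc j} eq = ⊥-elim (All.lookup px (∈-lookup j) eq)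
lookup-injective (px ∷ _) {suc i} {zero}  eq = ⊥-elim (All.lookup px (∈-lookup i) (sym eq))
lookup-injective (_ ∷ u)  {suc i} {suc j} eq = cong suc (lookup-injective u eq)

closed-walk⇒cycle : ∀ {x z : V} {y ys} → Walk R x (y ∷ ys) z → R z x → Unique (y ∷ ys) →
                    IsCycle R (length ys) (lookup (y ∷ ys))
closed-walk⇒cycle {R = R} {y = y} {ys} w r u = lookup-injective u , adjacent
  where
  adjacent : ∀ i j → suc (toℕ i) % suc (length ys) ≡ toℕ j → R (lookup (y ∷ ys) i) (lookup (y ∷ ys) j)
  adjacent i j eq with ℕₚ.m≤n⇒m<n∨m≡n (Finₚ.toℕ<n i)
  ... | inj₁ lt = lookup-step w i j (trans (sym (m<n⇒m%n≡m lt)) eq)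
  -- The index after the last one is 0 modulo the length, so this pair needs the closing edge from
  -- `z` back to `x`.
  ... | inj₂ e
    rewrite lookup-last w i e
          | lookup-first w j (trans (sym eq) (trans (cong (_% suc (length ys)) e) (n%n≡0 (suc (length ys))))) = r

-- Splicing a block into a list without repetitions.

unique-++⁻ʳ : ∀ (xs : List V) {ys} → Unique (xs ++ ys) → Unique ys
unique-++⁻ʳ []       u       = u
unique-++⁻ʳ (_ ∷ xs) (_ ∷ u) = unique-++⁻ʳ xs u

unique-resp-↭ : ∀ {xs ys : List V} → xs ↭ ys → Unique xs → Unique ys
unique-resp-↭ {V} p = ↭ₛ.Unique-resp-↭ (setoid V) (↭⇒↭ₛ p)

All-replace : ∀ pre {a : V} A {C post} → All P C → All P (pre ++ a ∷ A ++ post) →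
              All P (pre ++ a ∷ C ++ post)
All-replace pre A pC all with Allₚ.++⁻ pre all
... | ppre , pa ∷ rest = Allₚ.++⁺ ppre (pa ∷ Allₚ.++⁺ pC (Allₚ.++⁻ʳ A rest))

-- `P` separates new entries from old, which makes `C` disjoint from what is kept; permuting `C` to
-- the front reduces the claim to an append. In use, `P` is membership in the fibre being attached.
unique-replace : ∀ pre {a : V} A {C post} → All P C → All (¬_ ∘ P) (pre ++ a ∷ A ++ post) → Unique C →
                 Unique (pre ++ a ∷ A ++ post) → Unique (pre ++ a ∷ C ++ post)
unique-replace {P = P} pre {a} A {C} {post} pC ¬p uC u =
  subst Unique (++-assoc pre [ a ] _) (unique-resp-↭ (↭-sym (shifts X C))
    (AllPairsₚ.++⁺ uC (unique-++⁻ʳ A (unique-resp-↭ (shifts X A) (subst Unique (sym (++-assoc pre [ a ] _)) u)))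
      (All.map (λ {c} pc → All.map (λ ¬px c≡x → ¬px (subst P c≡x pc)) ¬p′) pC)))
  where
  X = pre ++ [ a ]
  ¬p′ : All (¬_ ∘ P) (X ++ post)
  ¬p′ = subst (All (¬_ ∘ P)) (sym (++-assoc pre [ a ] post)) (All-replace pre A {C = []} [] ¬p)

-- Contiguous blocks and their survival under splicing.

Infix : List V → List V → Set
Infix ys xs = ∃₂ λ pre post → xs ≡ pre ++ ys ++ post

infix-++ˡ : ∀ pre {ys xs : List V} → Infix ys xs → Infix ys (pre ++ xs)
infix-++ˡ pre {ys} (p , q , refl) = pre ++ p , q , sym (++-assoc pre p (ys ++ q))

infix-++ʳ : ∀ post {ys xs : List V} → Infix ys xs → Infix ys (xs ++ post)
infix-++ʳ post {ys} (p , q , refl) =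
  p , q ++ post , trans (++-assoc p (ys ++ q) post) (cong (p ++_) (++-assoc ys q post))

infix-[] : ∀ (xs : List V) → Infix [] xs
infix-[] xs = [] , xs , refl

-- A nonempty `B` starts with an entry satisfying `P`, and no entry of `A` does, so the block cannot
-- begin inside `A`.
infix-tail : ∀ A {B post : List V} → All (¬_ ∘ P) A → All P B → Infix B (A ++ post) → Infix B post
infix-tail []      _         _         i = i
infix-tail (a ∷ A) (_ ∷ ¬pA) pB        (_ ∷ pre , q , eq) = infix-tail A ¬pA pB (pre , q , proj₂ (∷-injective eq))
infix-tail (a ∷ A) (_ ∷ ¬pA) []        ([] , _ , _)       = infix-[] _
infix-tail {P = P} (a ∷ A) (¬pa ∷ _) (pb ∷ _)  ([] , _ , eq)      =
  contradiction (subst P (sym (proj₁ (∷-injective eq))) pb) ¬pa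

prefix-before : ∀ pre {a : V} {rest} B {post} → ¬ P a → All P B → pre ++ a ∷ rest ≡ B ++ post →
                ∃ λ q → pre ≡ B ++ q
prefix-before pre       []      _   _        _    = pre , refl
prefix-before []        (_ ∷ _) ¬pa (pb ∷ _) refl = contradiction pb ¬pa
prefix-before (x ∷ pre) (b ∷ B) ¬pa (_ ∷ pB) eq with ∷-injective eq
... | refl , eq′ with prefix-before pre B ¬pa pB eq′
...   | q , refl = q , refl

-- The stretch `a ∷ A` avoids `P` entirely, so a block inside `P` can neither meet nor straddle it.
infix-split : ∀ pre {a : V} {A B post} → All (¬_ ∘ P) (a ∷ A) → All P B →
              Infix B (pre ++ a ∷ A ++ post) → Infix B pre ⊎ Infix B post
infix-split []        {a} {A} ¬pA pB i = inj₂ (infix-tail (a ∷ A) ¬pA pB i)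
infix-split (x ∷ pre) ¬pA pB (_ ∷ p , q , eq) with infix-split pre ¬pA pB (p , q , proj₂ (∷-injective eq))
... | inj₁ i = inj₁ (infix-++ˡ [ x ] i)
... | inj₂ i = inj₂ i
infix-split (x ∷ pre) {B = B} (¬pa ∷ _) pB ([] , q , eq) =
  inj₁ ([] , prefix-before (x ∷ pre) B ¬pa pB eq)

infix-replace : ∀ pre {a : V} {A B C post} → All (¬_ ∘ P) (a ∷ A) → All P B →
                Infix B (pre ++ a ∷ A ++ post) → Infix B (pre ++ a ∷ C ++ post)
infix-replace pre {a} {C = C} {post} ¬pA pB i =
  [ infix-++ʳ (a ∷ C ++ post) , infix-++ˡ pre ∘ infix-++ˡ (a ∷ C) ]′ (infix-split pre ¬pA pB i)

-- Finite stretches of a sequence.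

seg : (ℕ → V) → ℕ → ℕ → List V
seg f i zero    = []
seg f i (suc k) = f i ∷ seg f (suc i) k

seg-++ : ∀ (f : ℕ → V) i t k → seg f i (t ℕ.+ k) ≡ seg f i t ++ seg f (t ℕ.+ i) k
seg-++ f i zero    k = refl
seg-++ f i (suc t) k = cong (f i ∷_)
  (trans (seg-++ f (suc i) t k) (cong (λ j → seg f (suc i) t ++ seg f j k) (ℕₚ.+-suc t i)))

length-seg : ∀ (f : ℕ → V) i k → length (seg f i k) ≡ k
length-seg f i zero    = refl
length-seg f i (suc k) = cong suc (length-seg f (suc i) k)

seg-All : ∀ {f : ℕ → V} → (∀ i → P (f i)) → ∀ i k → All P (seg f i k)
seg-All p i zero    = []
seg-All p i (suc k) = p i ∷ seg-All p (suc i) k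

seg-walk : ∀ {f : ℕ → V} → (∀ i → R (f i) (f (suc i))) → ∀ i k → Walk R (f i) (seg f i (suc k)) (f (k ℕ.+ i))
seg-walk r i zero    = single _
seg-walk {R = R} {f} r i (suc k) =
  step (r i) (subst (λ j → Walk R (f (suc i)) (seg f (suc i) (suc k)) (f j)) (ℕₚ.+-suc k i) (seg-walk r (suc i) k))

seg-unique : ∀ {f : ℕ → V} {n} → (∀ {i j} → i ℕ.< j → j ℕ.< n → f i ≢ f j) →
             ∀ i k → i ℕ.+ k ℕ.≤ n → Unique (seg f i k)
seg-unique           f≢ i zero    _  = []
seg-unique {f = f} {n} f≢ i (suc k) le = fresh (suc i) k ℕₚ.≤-refl le′ ∷ seg-unique f≢ (suc i) k le′
  where
  le′ : suc i ℕ.+ k ℕ.≤ n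
  le′ = subst (ℕ._≤ n) (ℕₚ.+-suc i k) le
  fresh : ∀ j l → i ℕ.< j → j ℕ.+ l ℕ.≤ n → All (f i ≢_) (seg f j l)
  fresh j zero    _   _   = []
  fresh j (suc l) i<j j+l = f≢ i<j (ℕₚ.≤-trans (s≤s (ℕₚ.m≤m+n j l)) j+l′) ∷ fresh (suc j) l (ℕₚ.m≤n⇒m≤1+n i<j) j+l′
    where
    j+l′ : suc j ℕ.+ l ℕ.≤ n
    j+l′ = subst (ℕ._≤ n) (ℕₚ.+-suc j l) j+l

-- Arithmetic modulo n.

*-distribʳ-- : ∀ x y z → (x - y) * z ≡ x * z + - (y * z)
*-distribʳ-- = solve-∀

pos-∸ : ∀ {i j} → i ℕ.≤ j → + (j ℕ.∸ i) ≡ + j - + i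
pos-∸ {i} {j} i≤j = trans (sym (ℤₚ.⊖-≥ i≤j)) (sym (ℤₚ.m-n≡m⊖n j i))

-- Equal quotients put both numbers in one box of width s + 1, where they differ only by their
-- remainders.
∸≤-same-quotient : ∀ x y s → x / suc s ≡ y / suc s → y ℕ.∸ x ℕ.≤ s
∸≤-same-quotient x y s eq = ℕₚ.m≤n+o⇒m∸n≤o y x (begin
  y                                     ≡⟨ m≡m%n+[m/n]*n y (suc s) ⟩
  y ℕ.% suc s ℕ.+ (y / suc s) ℕ.* suc s ≤⟨ ℕₚ.+-mono-≤ (ℕₚ.≤-pred (m%n<n y (suc s))) (ℕₚ.≤-reflexive (cong (ℕ._* suc s) (sym eq))) ⟩
  s ℕ.+ (x / suc s) ℕ.* suc s           ≤⟨ ℕₚ.+-monoʳ-≤ s (m/n*n≤m x (suc s)) ⟩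
  s ℕ.+ x                               ≡⟨ ℕₚ.+-comm s x ⟩
  x ℕ.+ s                               ∎)
  where open ℕₚ.≤-Reasoning

module Congruence (n : ℕ) .{{_ : NonZero n}} where

  infix 4 _≋_

  -- A record rather than a synonym for divisibility, so that x and y can be inferred.
  record _≋_ (x y : ℤ) : Set where
    constructor congruent
    field divisible : + n ∣ x - y

  ≋-reflexive : ∀ {x y} → x ≡ y → x ≋ y
  ≋-reflexive {x} refl = congruent (divides (+ 0) (ℤₚ.+-inverseʳ x))

  ≋-sym : ∀ {x y} → x ≋ y → y ≋ x
  ≋-sym {x} {y} (congruent p) = congruent (subst (+ n ∣_) (lemma x y) (∣m⇒∣-m p))
    where
    lemma : ∀ x y → - (x - y) ≡ y - x
    lemma = solve-∀

  ≋-trans : ∀ {x y z} → x ≋ y → y ≋ z → x ≋ z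
  ≋-trans {x} {y} {z} (congruent p) (congruent q) = congruent (subst (+ n ∣_) (lemma x y z) (∣m∣n⇒∣m+n p q))
    where
    lemma : ∀ x y z → (x - y) + (y - z) ≡ x - z
    lemma = solve-∀

  ≋-+ : ∀ {x y z w} → x ≋ y → z ≋ w → x + z ≋ y + w
  ≋-+ {x} {y} {z} {w} (congruent p) (congruent q) = congruent (subst (+ n ∣_) (lemma x y z w) (∣m∣n⇒∣m+n p q))
    where
    lemma : ∀ x y z w → (x - y) + (z - w) ≡ (x + z) - (y + w)
    lemma = solve-∀

  ≋-neg : ∀ {x y} → x ≋ y → - x ≋ - y
  ≋-neg {x} {y} (congruent p) = congruent (subst (+ n ∣_) (lemma x y) (∣m⇒∣-m p))
    where
    lemma : ∀ x y → - (x - y) ≡ - x - - y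
    lemma = solve-∀

  ≋-*ˡ : ∀ c {x y} → x ≋ y → c * x ≋ c * y
  ≋-*ˡ c {x} {y} (congruent p) = congruent (subst (+ n ∣_) (lemma c x y) (∣n⇒∣m*n c p))
    where
    lemma : ∀ c x y → c * (x - y) ≡ c * x - c * y
    lemma = solve-∀

  ≋-*ʳ : ∀ c {x y} → x ≋ y → x * c ≋ y * c
  ≋-*ʳ c {x} {y} (congruent p) = congruent (subst (+ n ∣_) (lemma c x y) (∣n⇒∣m*n c p))
    where
    lemma : ∀ c x y → c * (x - y) ≡ x * c - y * c
    lemma = solve-∀

  n*≋0 : ∀ x → + n * x ≋ + 0
  n*≋0 x = congruent (divides x (trans (ℤₚ.+-identityʳ (+ n * x)) (ℤₚ.*-comm (+ n) x)))

  %ℕ-≋ : ∀ z → + (z %ℕ n) ≋ z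
  %ℕ-≋ z = congruent (divides (- (z /ℕ n))
    (trans (cong (λ w → + (z %ℕ n) - w) (a≡a%ℕn+[a/ℕn]*n z n)) (lemma (+ (z %ℕ n)) (z /ℕ n) (+ n))))
    where
    lemma : ∀ r q k → r - (r + q * k) ≡ (- q) * k
    lemma = solve-∀

  residue : ℤ → Fin n
  residue z = fromℕ< (n%ℕd<d z n)

  residue-≋ : ∀ z → + toℕ (residue z) ≋ z
  residue-≋ z = subst (λ k → + k ≋ z) (sym (Finₚ.toℕ-fromℕ< (n%ℕd<d z n))) (%ℕ-≋ z)

  residue-injective : ∀ {z w} → residue z ≡ residue w → z ≋ w
  residue-injective {z} {w} eq =
    ≋-trans (≋-sym (residue-≋ z)) (subst (λ r → + toℕ r ≋ w) (sym eq) (residue-≋ w))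

  -- As `g` is coprime to `n`, divisibility of `t g` by `n` passes to `t`, which is too small. Hence
  -- a loop voltage generates ℤ_n.
  coprime-multiple≢0 : ∀ {g t} → Coprime ∣ g ∣ n → 1 ℕ.≤ t → t ℕ.< n → ¬ (+ t * g ≋ + 0)
  coprime-multiple≢0 {g} {suc t} c _ t<n (congruent p) = ℕDiv.>⇒∤ t<n
    (coprime-divisor (Coprimality.sym c)
      (subst (n ℕDiv.∣_) (trans (cong ∣_∣ (ℤₚ.+-identityʳ (+ suc t * g)))
          (trans (ℤₚ.abs-* (+ suc t) g) (ℕₚ.*-comm (suc t) ∣ g ∣)))
        (∣⇒∣ᵤ p)))

  multiples-≢ : ∀ {g i j} → Coprime ∣ g ∣ n → i ℕ.< j → j ℕ.< n → ¬ (+ i * g ≋ + j * g)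
  multiples-≢ {g} {i} {j} c i<j j<n p = coprime-multiple≢0 {g} c (ℕₚ.m<n⇒0<n∸m i<j) (ℕₚ.≤-<-trans (ℕₚ.m∸n≤m j i) j<n)
    (≋-trans (≋-reflexive (trans (cong (_* g) (pos-∸ (ℕₚ.<⇒≤ i<j))) (*-distribʳ-- (+ j) (+ i) g)))
      (≋-trans (≋-+ {x = + j * g} (≋-sym p) (≋-reflexive {x = - (+ i * g)} refl))
        (≋-reflexive (ℤₚ.+-inverseʳ (+ i * g)))))

  -- The Bézout coefficient of |h| is the inverse, up to a sign that depends on the form of the
  -- identity and on the sign of `h`.
  inverse : ∀ {h} → Coprime ∣ h ∣ n → ∃ λ c → c * h ≋ + 1
  inverse {h} c = signed h (natural (coprime-Bézout c))
    where
    natural : ∀ {k} → Bézout.Identity 1 k n → ∃ λ c → c * + k ≋ + 1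
    natural {k} (Bézout.+- x y eq) = + x , congruent (divides (+ y)
      (trans (cong (_- + 1) (trans (sym (ℤₚ.pos-* x k)) (trans (cong +_ (sym eq))
          (trans (ℤₚ.pos-+ 1 (y ℕ.* n)) (cong (_+_ (+ 1)) (ℤₚ.pos-* y n))))))
        (lemma (+ y * + n))))
      where
      lemma : ∀ z → (+ 1 + z) - + 1 ≡ z
      lemma = solve-∀
    natural {k} (Bézout.-+ x y eq) = - (+ x) , congruent (divides (- (+ y))
      (trans (lemma (+ x) (+ k)) (trans
        (cong -_ (trans (cong (_+_ (+ 1)) (sym (ℤₚ.pos-* x k))) (trans (cong +_ eq) (ℤₚ.pos-* y n))))
        (ℤₚ.neg-distribˡ-* (+ y) (+ n)))))
      where
      lemma : ∀ x k → (- x) * k - + 1 ≡ - (+ 1 + x * k)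
      lemma = solve-∀
    signed : ∀ h → (∃ λ c → c * + ∣ h ∣ ≋ + 1) → ∃ λ c → c * h ≋ + 1
    signed (+ _)    p       = p
    signed -[1+ k ] (c , p) = - c , ≋-trans (≋-reflexive (lemma c (+ suc k))) p
      where
      lemma : ∀ c k → (- c) * (- k) ≡ c * k
      lemma = solve-∀

  -- An exchange rate between two fibres: `t` steps by `a` move as far as `r` steps by `g`. For `g`
  -- coprime to `n`, the latter visit `r + 1 ≤ n` distinct points and miss fewer than `s`.
  record Approximation (Q s : ℕ) (a h : ℤ) : Set where
    field
      t r      : ℕ
      g        : ℤ
      sign     : g ≡ h ⊎ g ≡ - h
      1≤t      : 1 ℕ.≤ t
      t≤Q      : t ℕ.≤ Q
      r<n      : r ℕ.< n
      n≤r+s    : n ℕ.≤ r ℕ.+ s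
      agree    : + t * a ≋ + r * g

  -- Dirichlet's approximation theorem for a / h modulo n: two of the Q + 1 residues of
  -- t a / h, 0 ≤ t ≤ Q, share one of Q boxes of width s + 1.  The residue ±e so obtained
  -- is traversed the other way round, as ∓(n − e).
  approximation : ∀ {Q s a h} → Q ℕ.< n → n ℕ.< Q ℕ.* suc s → Coprime ∣ a ∣ n → Coprime ∣ h ∣ n →
                  Approximation Q s a h
  approximation {Q} {s} {a} {h} Q<n n<Qs ca ch = conclude (ℕₚ.≤-total (x i) (x j))
    where
    c = proj₁ (inverse {h} ch)
    x : ℕ → ℕ
    x t = (+ t * (a * c)) %ℕ n

    x-spec : ∀ t → + x t * h ≋ + t * a
    x-spec t = ≋-trans (≋-*ʳ h (%ℕ-≋ (+ t * (a * c))))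
      (≋-trans (≋-reflexive (lemma (+ t) a c h))
        (≋-trans (≋-*ˡ (+ t * a) (proj₂ (inverse {h} ch))) (≋-reflexive (ℤₚ.*-identityʳ (+ t * a)))))
      where
      lemma : ∀ t a c h → (t * (a * c)) * h ≡ (t * a) * (c * h)
      lemma = solve-∀

    box< : ∀ t → x t / suc s ℕ.< Q
    box< t = m<n*o⇒m/o<n (ℕₚ.<-trans (n%ℕd<d (+ t * (a * c)) n) n<Qs)

    pigeons = Finₚ.pigeonhole (ℕₚ.n<1+n Q) (λ t → fromℕ< (box< (toℕ t)))
    i = toℕ (proj₁ pigeons)
    j = toℕ (proj₁ (proj₂ pigeons))
    i<j : i ℕ.< j
    i<j = proj₁ (proj₂ (proj₂ pigeons))
    j≤Q : j ℕ.≤ Q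
    j≤Q = ℕₚ.≤-pred (Finₚ.toℕ<n (proj₁ (proj₂ pigeons)))
    same : x i / suc s ≡ x j / suc s
    same = Finₚ.fromℕ<-injective _ _ (box< i) (box< j) (proj₂ (proj₂ (proj₂ pigeons)))

    t≤Q : j ℕ.∸ i ℕ.≤ Q
    t≤Q = ℕₚ.≤-trans (ℕₚ.m∸n≤m j i) j≤Q

    difference : + (j ℕ.∸ i) * a ≋ (+ x j - + x i) * h
    difference = ≋-trans (≋-reflexive (trans (cong (_* a) (pos-∸ (ℕₚ.<⇒≤ i<j))) (*-distribʳ-- (+ j) (+ i) a)))
      (≋-trans (≋-+ (≋-sym (x-spec j)) (≋-neg (≋-sym (x-spec i)))) (≋-reflexive (sym (*-distribʳ-- (+ x j) (+ x i) h))))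

    build : ∀ e g → g ≡ h ⊎ g ≡ - h → e ℕ.≤ s → e ℕ.< n → + (j ℕ.∸ i) * a ≋ - (+ e * g) → Approximation Q s a h
    -- Equal residues would give `t a = 0` in ℤ_n with 1 ≤ t ≤ Q < n, which coprimality of `a`
    -- forbids; so e ≥ 1 and n - e < n.
    build zero g _ _ _ p = contradiction p
      (coprime-multiple≢0 {a} ca (ℕₚ.m<n⇒0<n∸m i<j) (ℕₚ.≤-<-trans t≤Q Q<n))
    build e@(suc e′) g sg e≤s e<n p = record
      { t = j ℕ.∸ i ; r = n ℕ.∸ e ; g = g ; sign = sg
      ; 1≤t = ℕₚ.m<n⇒0<n∸m i<j ; t≤Q = t≤Q
      ; r<n = ℕₚ.∸-monoʳ-< (s≤s z≤n) (ℕₚ.<⇒≤ e<n)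
      ; n≤r+s = ℕₚ.≤-trans (ℕₚ.≤-reflexive (sym (ℕₚ.m∸n+n≡m (ℕₚ.<⇒≤ e<n)))) (ℕₚ.+-monoʳ-≤ (n ℕ.∸ e) e≤s)
      ; agree = ≋-trans p (≋-sym (≋-trans (≋-reflexive (trans (cong (_* g) (pos-∸ (ℕₚ.<⇒≤ e<n))) (*-distribʳ-- (+ n) (+ e) g)))
          (≋-trans (≋-+ (n*≋0 g) (≋-reflexive {x = - (+ e * g)} refl)) (≋-reflexive (ℤₚ.+-identityˡ (- (+ e * g)))))))
      }

    conclude : x i ℕ.≤ x j ⊎ x j ℕ.≤ x i → Approximation Q s a h
    -- The sign of `g` is chosen against the sign of the difference, so that `t a = - e g` with e ≥
    -- 0 in both cases.
    conclude (inj₁ le) = build (x j ℕ.∸ x i) (- h) (inj₂ refl) (∸≤-same-quotient (x i) (x j) s same)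
      (ℕₚ.≤-<-trans (ℕₚ.m∸n≤m (x j) (x i)) (n%ℕd<d (+ j * (a * c)) n))
      (≋-trans difference (≋-reflexive (trans (cong (_* h) (sym (pos-∸ le))) (lemma (+ (x j ℕ.∸ x i)) h))))
      where
      lemma : ∀ e h → e * h ≡ - (e * - h)
      lemma = solve-∀
    conclude (inj₂ le) = build (x i ℕ.∸ x j) h (inj₁ refl) (∸≤-same-quotient (x j) (x i) s (sym same))
      (ℕₚ.≤-<-trans (ℕₚ.m∸n≤m (x i) (x j)) (n%ℕd<d (+ i * (a * c)) n))
      (≋-trans difference (≋-reflexive (trans (lemma (+ x j) (+ x i) h) (cong (λ e → - (e * h)) (sym (pos-∸ le))))))
      where
      lemma : ∀ y x h → (y - x) * h ≡ - ((x - y) * h)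
      lemma = solve-∀

-- Fibres of the lift.

module Growth (m n : ℕ) .{{_ : NonZero n}}
  (adj : Fin m → Fin m → Bool) (adj-sym : ∀ u v → adj u v ≡ adj v u)
  (σ : Fin m → Fin m → ℤ) (volt : IsVoltage m n adj σ)
  (ℓ : Fin m → ℤ) (ℓ-coprime : ∀ u → Coprime ∣ ℓ u ∣ n)
  (Q s : ℕ) where

  open Congruence n
  open import Data.List.Membership.DecPropositional (Finₚ._≟_ {m}) using (_∈?_)

  Vertex : Set
  Vertex = Fin m × Fin n

  _~_ : Vertex → Vertex → Set
  _~_ = LiftAdj m n adj σ ℓ

  -- Positions in a fibre are computed as integers and reduced only to name a vertex, so that ring
  -- identities apply.
  point : Fin m → ℤ → Vertex
  point u z = u , residue z

  voltage-residues : ∀ z w {x} → w - z ≋ x → (+ toℕ (residue w) - + toℕ (residue z)) ≡[mod n ] x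
  voltage-residues z w p =
    ∣⇒∣ᵤ (_≋_.divisible (≋-trans (≋-+ (residue-≋ w) (≋-neg (residue-≋ z))) p))

  edge : ∀ {u v} z w → adj u v ≡ true → w - z ≋ σ u v → point u z ~ point v w
  edge z w uv p = inj₁ (uv , voltage-residues z w p)

  IsLoop : Fin m → ℤ → Set
  IsLoop u g = g ≡ ℓ u ⊎ g ≡ - ℓ u

  loop : ∀ {u g} z w → IsLoop u g → w - z ≋ g → point u z ~ point u w
  loop z w (inj₁ refl) p = inj₂ (refl , inj₁ (voltage-residues z w p))
  loop z w (inj₂ refl) p = inj₂ (refl , inj₂ (voltage-residues z w p))

  loop-coprime : ∀ {u g} → IsLoop u g → Coprime ∣ g ∣ n
  loop-coprime {u} (inj₁ refl) = ℓ-coprime u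
  loop-coprime {u} (inj₂ refl) = subst (λ k → Coprime k n) (sym (ℤₚ.∣-i∣≡∣i∣ (ℓ u))) (ℓ-coprime u)

  -- For a loop voltage `g` coprime to `n`, the first `n` terms run through the fibre once.
  orbit : Fin m → ℤ → ℤ → ℕ → Vertex
  orbit u b g i = point u (b + + i * g)

  orbit-step : ∀ {u} b {g} → IsLoop u g → ∀ i → orbit u b g i ~ orbit u b g (suc i)
  orbit-step b {g} lg i = loop (b + + i * g) (b + + suc i * g) lg (≋-reflexive
    (trans (cong (λ k → b + k * g - (b + + i * g)) (ℤₚ.pos-+ 1 i)) (lemma b (+ i) g)))
    where
    lemma : ∀ b i g → b + (+ 1 + i) * g - (b + i * g) ≡ g
    lemma = solve-∀

  orbit-distinct : ∀ {u} b {g} → IsLoop u g → ∀ {i j} → i ℕ.< j → j ℕ.< n → orbit u b g i ≢ orbit u b g j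
  orbit-distinct b {g} lg {i} {j} i<j j<n eq = multiples-≢ {g} (loop-coprime lg) i<j j<n
    (≋-trans (≋-reflexive (lemma b (+ i * g)))
      (≋-trans (≋-+ (≋-reflexive { - b} refl) (residue-injective (cong proj₂ eq)))
        (≋-reflexive (sym (lemma b (+ j * g))))))
    where
    lemma : ∀ b x → x ≡ - b + (b + x)
    lemma = solve-∀

  orbit-unique : ∀ {u} b {g} → IsLoop u g → ∀ {k} → k ℕ.≤ n → Unique (seg (orbit u b g) 0 k)
  orbit-unique b lg {k} = seg-unique (orbit-distinct b lg) 0 k

  -- Partial cycles with reserved arcs.

  unvisited : List (Fin m) → Fin m → ℕ
  unvisited U u = length (filterᵇ (adj u) U)

  -- Each detour cut from the arc uses at most `Q` steps, so `Q` are reserved per neighbour in `U`;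
  -- the additional 1 is there because `k` vertices make `k - 1` steps.
  record FreeArc (path : List Vertex) (U : List (Fin m)) (u : Fin m) : Set where
    field
      b g    : ℤ
      i k    : ℕ
      isLoop : IsLoop u g
      wide   : suc (Q ℕ.* unvisited U u) ℕ.≤ k
      inside : Infix (seg (orbit u b g) i k) path

  -- A long cycle above the complement of U, written as a closed path, on which
  -- every fibre still has room for the detours to the neighbours in U; j fibres have
  -- been attached to the initial one.
  record State (j : ℕ) (U : List (Fin m)) : Set where
    field
      path       : List Vertex
      start stop : Vertex
      walk       : Walk _~_ start path stop
      closing    : stop ~ start
      unique     : Unique path
      covered    : All (λ x → proj₁ x ∉ U) path
      long       : suc j ℕ.* n ℕ.≤ length path ℕ.+ j ℕ.* (s ℕ.+ Q)
      arcs       : ∀ u → u ∉ U → FreeArc path U u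

  -- The whole fibre of `root` serves both as the cycle and as its own free arc.
  initial : ∀ root U → root ∉ U → (∀ u → u ∉ U → u ≡ root) → suc (Q ℕ.* unvisited U root) ℕ.≤ n → State 0 U
  initial root U root∉U others room = record
    { path = path ; start = f 0 ; stop = f (ℕ.pred n ℕ.+ 0)
    ; walk = subst (λ k → Walk _~_ (f 0) (seg f 0 k) (f (ℕ.pred n ℕ.+ 0))) (ℕₚ.suc-pred n)
        (seg-walk (orbit-step (+ 0) (inj₁ refl)) 0 (ℕ.pred n))
    ; closing = loop (+ 0 + + (ℕ.pred n ℕ.+ 0) * ℓ root) (+ 0 + + 0 * ℓ root) (inj₁ refl) back
    ; unique = orbit-unique (+ 0) (inj₁ refl) ℕₚ.≤-refl
    ; covered = seg-All (λ _ → root∉U) 0 n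
    ; long = ℕₚ.≤-reflexive (cong (ℕ._+ 0) (sym (length-seg f 0 n)))
    ; arcs = λ u u∉U → subst (FreeArc path U) (sym (others u u∉U)) (record
        { b = + 0 ; g = ℓ root ; i = 0 ; k = n ; isLoop = inj₁ refl ; wide = room
        ; inside = [] , [] , sym (++-identityʳ path) })
    }
    where
    f = orbit root (+ 0) (ℓ root)
    path = seg f 0 n
    -- The last and first vertices differ by `-(n - 1) ℓ root`, which is `ℓ root` modulo `n`.
    back : (+ 0 + + 0 * ℓ root) - (+ 0 + + (ℕ.pred n ℕ.+ 0) * ℓ root) ≋ ℓ root
    back = ≋-trans (≋-reflexive (trans
        (cong (λ k → (+ 0 + + 0 * ℓ root) - (+ 0 + k * ℓ root))
          (trans (cong +_ (ℕₚ.+-identityʳ (ℕ.pred n))) pred-pos))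
        (lemma (+ n) (ℓ root))))
      (≋-trans (≋-+ (≋-reflexive {ℓ root} refl) (≋-neg (n*≋0 (ℓ root)))) (≋-reflexive (ℤₚ.+-identityʳ (ℓ root))))
      where
      pred-pos : + ℕ.pred n ≡ + n - + 1
      pred-pos = trans (lemma₁ (+ ℕ.pred n)) (cong (_- + 1) (trans (sym (ℤₚ.pos-+ 1 (ℕ.pred n))) (cong +_ (ℕₚ.suc-pred n))))
        where
        lemma₁ : ∀ x → x ≡ (+ 1 + x) - + 1
        lemma₁ = solve-∀
      lemma : ∀ k g → (+ 0 + + 0 * g) - (+ 0 + (k - + 1) * g) ≡ g + - (k * g)
      lemma = solve-∀

  unvisited-∷-adjacent : ∀ {u v} U → adj u v ≡ true → unvisited (v ∷ U) u ≡ suc (unvisited U u)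
  unvisited-∷-adjacent U uv rewrite uv = refl

  unvisited-∷ : ∀ u v U → unvisited U u ℕ.≤ unvisited (v ∷ U) u
  unvisited-∷ u v U with adj u v
  ... | true  = ℕₚ.n≤1+n _
  ... | false = ℕₚ.≤-refl

  unvisited-↭ : ∀ u {U W} → U ↭ W → unvisited U u ≡ unvisited W u
  unvisited-↭ u p = ↭-length (filter-↭ (T? ∘ adj u) p)

  -- Allows the fibre chosen next to be moved to the front of `U`.
  state-↭ : ∀ {j U W} → U ↭ W → State j U → State j W
  state-↭ {U = U} {W} p S = record
    { path = path ; start = start ; stop = stop ; walk = walk ; closing = closing
    ; unique = unique ; long = long
    ; covered = All.map (λ x∉ → x∉ ∘ ∈-resp-↭ (↭-sym p)) covered
    ; arcs = λ u u∉W → let open FreeArc (arcs u (u∉W ∘ ∈-resp-↭ p)) in record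
        { b = b ; g = g ; i = i ; k = k ; isLoop = isLoop ; inside = inside
        ; wide = subst (λ d → suc (Q ℕ.* d) ℕ.≤ k) (unvisited-↭ u p) wide }
    }
    where open State S

  -- The first vertex of the walk that lies in `U` is entered from outside, by the edge returned
  -- here.
  crossing : ∀ {u w} U → Star (SimpleAdj m adj) u w → u ∉ U → w ∈ U →
             ∃₂ λ x y → x ∉ U × y ∈ U × adj x y ≡ true
  crossing U done u∉ w∈ = contradiction w∈ u∉
  crossing U (_◅_ {j = x} ux xs) u∉ w∈ with x ∈? U
  ... | yes x∈ = _ , _ , u∉ , x∈ , ux
  ... | no  x∉ = crossing U xs x∉ w∈

  -- Attaching the fibres along edges.

  module _ {Δ : ℕ} (Q<n : Q ℕ.< n) (n<Qs : n ℕ.< Q ℕ.* suc s) (room : s ℕ.+ Q ℕ.* Δ ℕ.≤ n) where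

    -- The arc of `u` is left after its first vertex, the fibre of `v` is followed for `r` steps of
    -- `g′`, and the arc is rejoined `t` steps further on. The return fits because `t g` and `r g′`
    -- agree modulo `n` and the voltages of the two crossings cancel.
    attach : ∀ {j u v U} → adj u v ≡ true → v ∉ U → unvisited U v ℕ.≤ Δ →
             (S : State j (v ∷ U)) (F : FreeArc (State.path S) (v ∷ U) u) →
             Approximation Q s (FreeArc.g F) (ℓ v) → State (suc j) U
    attach {j} {u} {v} {U} uv v∉U degv S F approx = record
      { path = path′ ; start = start ; stop = stop ; closing = closing
      ; walk = walk-replace pre A {C} depart (seg-walk (orbit-step b′ sign) 0 r) return
          (subst (λ p → Walk _~_ start p stop) path≡ walk)
      ; unique = unique-replace {P = λ x → proj₁ x ≡ v} pre A {C} (seg-All (λ _ → refl) 0 (suc r))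
          (All.map (λ x∉ → x∉ ∘ here) covered₀) (orbit-unique b′ sign r<n) (subst Unique path≡ unique)
      ; covered = All-replace pre A {C} (seg-All (λ _ → v∉U) 0 (suc r)) (All.map (λ x∉ → x∉ ∘ there) covered₀)
      ; long = long′
      ; arcs = arcs′
      }
      where
      open State S
      open FreeArc F
      open Approximation approx renaming (g to g′)

      -- Cutting `t` steps removes the `t - 1` vertices strictly between the ends, hence the
      -- predecessor.
      t′ = proj₁ (ℕₚ.m≤n⇒∃[o]m+o≡n 1≤t)
      t≡ : suc t′ ≡ t
      t≡ = proj₂ (ℕₚ.m≤n⇒∃[o]m+o≡n 1≤t)

      -- As `v` is a neighbour of `u`, the reserve needed at `u` drops by `Q` when `v` leaves the
      -- list; this pays for the `t` steps.
      spare : suc (t ℕ.+ Q ℕ.* unvisited U u) ℕ.≤ k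
      spare = ℕₚ.≤-trans (s≤s (ℕₚ.≤-trans (ℕₚ.+-monoˡ-≤ _ t≤Q)
        (ℕₚ.≤-reflexive (trans (sym (ℕₚ.*-suc Q _)) (cong (Q ℕ.*_) (sym (unvisited-∷-adjacent U uv))))))) wide

      t<k : t ℕ.< k
      t<k = ℕₚ.≤-trans (s≤s (ℕₚ.m≤m+n t _)) spare
      k′ = proj₁ (ℕₚ.m≤n⇒∃[o]m+o≡n t<k)
      k≡ : suc t′ ℕ.+ suc k′ ≡ k
      k≡ = trans (cong (ℕ._+ suc k′) t≡) (trans (ℕₚ.+-suc t k′) (proj₂ (ℕₚ.m≤n⇒∃[o]m+o≡n t<k)))

      pre = proj₁ inside
      post = proj₁ (proj₂ inside)
      f = orbit u b g
      b′ = b + + i * g + σ u v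
      h = orbit v b′ g′
      A = seg f (suc i) t′
      C = seg h 0 (suc r)
      rest = seg f (suc t′ ℕ.+ i) (suc k′) ++ post

      path′ : List Vertex
      path′ = pre ++ f i ∷ C ++ rest

      path≡ : path ≡ pre ++ f i ∷ A ++ rest
      path≡ = trans (proj₂ (proj₂ inside)) (cong (pre ++_)
        (trans (cong (_++ post) (trans (cong (seg f i) (sym k≡)) (seg-++ f i (suc t′) (suc k′))))
          (++-assoc (f i ∷ A) _ post)))

      covered₀ : All (λ x → proj₁ x ∉ v ∷ U) (pre ++ f i ∷ A ++ rest)
      covered₀ = subst (All _) path≡ covered

      depart : f i ~ h 0
      depart = edge (b + + i * g) (b′ + + 0 * g′) uv (≋-reflexive (lemma (b + + i * g) (σ u v) g′))
        where
        lemma : ∀ z x y → z + x + + 0 * y - z ≡ x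
        lemma = solve-∀

      return : h (r ℕ.+ 0) ~ f (suc t′ ℕ.+ i)
      return = edge (b′ + + (r ℕ.+ 0) * g′) (b + + (suc t′ ℕ.+ i) * g) (trans (adj-sym v u) uv)
        (≋-trans (≋-reflexive (trans (cong₂ (λ k l → b + k * g - (b′ + l * g′))
              (trans (cong (λ l → + (l ℕ.+ i)) t≡) (ℤₚ.pos-+ t i)) (cong +_ (ℕₚ.+-identityʳ r)))
            (lemma b (+ t) (+ i) g (σ u v) (+ r) g′)))
          (≋-trans (≋-+ (≋-+ agree (≋-reflexive { - (+ r * g′)} refl)) (≋-reflexive { - σ u v} refl))
            (≋-trans (≋-reflexive (lemma₁ (+ r * g′) (σ u v))) (≋-sym (congruent (∣ᵤ⇒∣ (volt u v uv)))))))
        where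
        lemma : ∀ b t i g x r y → b + (t + i) * g - (b + i * g + x + r * y) ≡ t * g + - (r * y) + - x
        lemma = solve-∀
        lemma₁ : ∀ y x → y + - y + - x ≡ - x
        lemma₁ = solve-∀

      -- The new fibre brings `r + 1` vertices with r ≥ n - s, and `t - 1 < Q` are lost: the
      -- shortfall is at most `s + Q`, with two vertices to spare.
      long′ : suc (suc j) ℕ.* n ℕ.≤ length path′ ℕ.+ suc j ℕ.* (s ℕ.+ Q)
      long′ = begin
        n ℕ.+ suc j ℕ.* n
          ≤⟨ ℕₚ.+-mono-≤ n≤r+s long ⟩
        (r ℕ.+ s) ℕ.+ (length path ℕ.+ j ℕ.* D)
          ≡⟨ cong (λ l → (r ℕ.+ s) ℕ.+ (l ℕ.+ j ℕ.* D)) (trans (cong length path≡) (length-spliced f (suc i) t′)) ⟩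
        (r ℕ.+ s) ℕ.+ ((length pre ℕ.+ suc (t′ ℕ.+ length rest)) ℕ.+ j ℕ.* D)
          ≤⟨ ℕₚ.+-monoʳ-≤ (r ℕ.+ s) (ℕₚ.+-monoˡ-≤ (j ℕ.* D) (ℕₚ.+-monoʳ-≤ (length pre) (ℕₚ.+-monoˡ-≤ (length rest) t≤Q′))) ⟩
        (r ℕ.+ s) ℕ.+ ((length pre ℕ.+ (Q ℕ.+ length rest)) ℕ.+ j ℕ.* D)
          ≡⟨ lemma r s (length pre) Q (length rest) (j ℕ.* D) ⟩
        (length pre ℕ.+ (r ℕ.+ length rest)) ℕ.+ (D ℕ.+ j ℕ.* D)
          ≤⟨ ℕₚ.+-monoˡ-≤ (D ℕ.+ j ℕ.* D) (ℕₚ.+-monoʳ-≤ (length pre) (ℕₚ.≤-trans (ℕₚ.n≤1+n _) (ℕₚ.n≤1+n _))) ⟩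
        (length pre ℕ.+ suc (suc r ℕ.+ length rest)) ℕ.+ (D ℕ.+ j ℕ.* D)
          ≡⟨ cong (ℕ._+ (D ℕ.+ j ℕ.* D)) (length-spliced h 0 (suc r)) ⟨
        length path′ ℕ.+ suc j ℕ.* D ∎
        where
        open ℕₚ.≤-Reasoning
        D = s ℕ.+ Q
        t≤Q′ : suc t′ ℕ.≤ Q
        t≤Q′ = subst (ℕ._≤ Q) (sym t≡) t≤Q
        length-spliced : ∀ (p : ℕ → Vertex) a l →
          length (pre ++ f i ∷ seg p a l ++ rest) ≡ length pre ℕ.+ suc (l ℕ.+ length rest)
        length-spliced p a l = trans (length-++ pre) (cong (λ x → length pre ℕ.+ suc x)
          (trans (length-++ (seg p a l)) (cong (ℕ._+ length rest) (length-seg p a l))))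
        lemma : ∀ r s p q l d → (r ℕ.+ s) ℕ.+ ((p ℕ.+ (q ℕ.+ l)) ℕ.+ d) ≡ (p ℕ.+ (r ℕ.+ l)) ℕ.+ ((s ℕ.+ q) ℕ.+ d)
        lemma = ℕ-solve-∀

      arcs′ : ∀ w → w ∉ U → FreeArc path′ U w
      arcs′ w w∉U with w Finₚ.≟ v | w Finₚ.≟ u
      -- The detour itself is the new free arc: r ≥ n - s, and `room` leaves `Q Δ` steps.
      ... | yes refl | _ = record
        { b = b′ ; g = g′ ; i = 0 ; k = suc r ; isLoop = sign
        ; wide = s≤s (ℕₚ.≤-trans (ℕₚ.*-monoʳ-≤ Q degv)
            (ℕₚ.+-cancelˡ-≤ s _ _ (ℕₚ.≤-trans room (ℕₚ.≤-trans n≤r+s (ℕₚ.≤-reflexive (ℕₚ.+-comm r s))))))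
        ; inside = infix-++ˡ pre (infix-++ˡ [ f i ] ([] , rest , refl))
        }
      -- The rest of the old arc starts where the detour rejoins it, so it stays contiguous.
      ... | no _ | yes refl = record
        { b = b ; g = g ; i = suc t′ ℕ.+ i ; k = suc k′ ; isLoop = isLoop
        ; wide = ℕₚ.+-cancelˡ-≤ t _ _ (ℕₚ.≤-trans (ℕₚ.≤-reflexive (ℕₚ.+-suc t _))
            (ℕₚ.≤-trans spare (ℕₚ.≤-reflexive (trans (sym k≡) (cong (ℕ._+ suc k′) t≡)))))
        ; inside = infix-++ˡ pre (infix-++ˡ (f i ∷ C) ([] , post , refl))
        }
      -- The removed stretch lies in the fibre of `u`, so arcs in other fibres are not cut.
      ... | no w≢v | no w≢u = record
        { b = W.b ; g = W.g ; i = W.i ; k = W.k ; isLoop = W.isLoop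
        ; wide = ℕₚ.≤-trans (s≤s (ℕₚ.*-monoʳ-≤ Q (unvisited-∷ w v U))) W.wide
        ; inside = infix-replace {P = λ x → proj₁ x ≡ w} pre {C = C} (seg-All (λ _ → w≢u ∘ sym) i (suc t′))
            (seg-All (λ _ → refl) W.i W.k) (subst (Infix _) path≡ W.inside)
        }
        where
        w∉ : w ∉ v ∷ U
        w∉ (here w≡v)  = w≢v w≡v
        w∉ (there w∈U) = w∉U w∈U
        module W = FreeArc (arcs w w∉)

    extend : ∀ {j u v U} → adj u v ≡ true → u ∉ v ∷ U → v ∉ U → unvisited U v ℕ.≤ Δ →
             State j (v ∷ U) → State (suc j) U
    extend {u = u} {v} uv u∉ v∉U degv S = attach uv v∉U degv S F
      (approximation {h = ℓ v} Q<n n<Qs (loop-coprime (FreeArc.isLoop F)) (ℓ-coprime v))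
      where F = State.arcs S u u∉

    -- Induction on the number `k` of missing fibres. As `root` stays covered, the walk from it to a
    -- member of `U` must cross into `U`, which supplies the edge for the next attachment.
    grow : ∀ {root j} k U → length U ≡ k → Unique U → root ∉ U → (∀ u v → Star (SimpleAdj m adj) u v) →
           (∀ u → unvisited U u ℕ.≤ Δ) → State j U → State (k ℕ.+ j) []
    grow zero [] _ _ _ _ _ S = S
    grow {root} {j} (suc k) U@(w ∷ _) len uniq root∉ conn deg S with crossing U (conn root w) root∉ (here refl)
    ... | u , v , u∉ , v∈ , uv with ∈-∃++ v∈
    ...   | U₁ , U₂ , eq = subst (λ l → State l []) (ℕₚ.+-suc k j)
            (grow k U′ len′ uniq′ (root∉ ∘ sub) conn deg′
              (extend uv (u∉ ∘ ∈-resp-↭ (↭-sym p)) v∉ (deg′ v) (state-↭ p S)))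
      where
      U′ = U₁ ++ U₂
      p : U ↭ v ∷ U′
      p = subst (_↭ v ∷ U′) (sym eq) (shift v U₁ U₂)
      len′ : length U′ ≡ k
      len′ = ℕₚ.suc-injective (trans (sym (↭-length p)) len)
      sub : ∀ {x} → x ∈ U′ → x ∈ U
      sub = ∈-resp-↭ (↭-sym p) ∘ there
      deg′ : ∀ u → unvisited U′ u ℕ.≤ Δ
      deg′ u = ℕₚ.≤-trans (unvisited-∷ u v U′) (ℕₚ.≤-trans (ℕₚ.≤-reflexive (sym (unvisited-↭ u p))) (deg u))
      uniq″ = unique-resp-↭ p uniq
      uniq′ : Unique U′
      uniq′ = unique-++⁻ʳ [ v ] uniq″
      v∉ : v ∉ U′
      v∉ v∈U′ with uniq″
      ... | v≢ ∷ _ = All.lookup v≢ v∈U′ refl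

  state⇒cycle : ∀ {j} → State j [] → Σ ℕ λ k → Σ (Fin (suc k) → Vertex) λ c →
                IsCycle _~_ k c × suc j ℕ.* n ℕ.≤ suc k ℕ.+ j ℕ.* (s ℕ.+ Q)
  state⇒cycle record { path = [] ; walk = () }
  state⇒cycle record { path = y ∷ ys ; walk = walk ; closing = closing ; unique = unique ; long = long } =
    length ys , lookup (y ∷ ys) , closed-walk⇒cycle walk closing unique , long

-- Clearing denominators and choosing the parameters.

m<[1+m/n]*n : ∀ m n .{{_ : NonZero n}} → m ℕ.< suc (m / n) ℕ.* n
m<[1+m/n]*n m n = subst (ℕ._< suc (m / n) ℕ.* n) (sym (m≡m%n+[m/n]*n m n)) (ℕₚ.+-monoˡ-< _ (m%n<n m n))

toℚᵘ-/1 : ∀ x → toℚᵘ ((+ x) ℚ./ 1) ℚᵘ.≃ mkℚᵘ (+ x) 0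
toℚᵘ-/1 x = ℚₚ.toℚᵘ-fromℚᵘ (mkℚᵘ (+ x) 0)

-- Between unnormalised fractions the inequality is a cross-multiplication of integers.
5Δ≤nε²-clear : ∀ {Δ n p d} .(c : Coprime p (suc d)) → let ε = mkℚ (+ p) d c in
  (+ (5 ℕ.* Δ)) ℚ./ 1 ℚ.≤ ((+ n) ℚ./ 1) ℚ.* (ε ℚ.* ε) →
  5 ℕ.* Δ ℕ.* (suc d ℕ.* suc d) ℕ.≤ n ℕ.* (p ℕ.* p)
5Δ≤nε²-clear {Δ} {n} {p} {d} c le = clear (begin
    mkℚᵘ (+ (5 ℕ.* Δ)) 0                       ≃⟨ toℚᵘ-/1 (5 ℕ.* Δ) ⟨
    toℚᵘ ((+ (5 ℕ.* Δ)) ℚ./ 1)                 ≤⟨ ℚₚ.toℚᵘ-mono-≤ le ⟩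
    toℚᵘ (((+ n) ℚ./ 1) ℚ.* (ε ℚ.* ε))         ≃⟨ ℚₚ.toℚᵘ-homo-* ((+ n) ℚ./ 1) (ε ℚ.* ε) ⟩
    toℚᵘ ((+ n) ℚ./ 1) ℚᵘ.* toℚᵘ (ε ℚ.* ε)     ≃⟨ ℚᵘₚ.*-cong (toℚᵘ-/1 n) (ℚₚ.toℚᵘ-homo-* ε ε) ⟩
    mkℚᵘ (+ n) 0 ℚᵘ.* (toℚᵘ ε ℚᵘ.* toℚᵘ ε)     ∎)
  where
  open ℚᵘₚ.≤-Reasoning
  ε = mkℚ (+ p) d c
  clear : mkℚᵘ (+ (5 ℕ.* Δ)) 0 ℚᵘ.≤ mkℚᵘ (+ n) 0 ℚᵘ.* (toℚᵘ ε ℚᵘ.* toℚᵘ ε) →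
          5 ℕ.* Δ ℕ.* (suc d ℕ.* suc d) ℕ.≤ n ℕ.* (p ℕ.* p)
  clear (*≤* le′) = ℤₚ.drop‿+≤+ (subst₂ ℤ._≤_
    (trans (cong (λ k → + (5 ℕ.* Δ) * + k) (ℕₚ.*-identityˡ (suc d ℕ.* suc d))) (sym (ℤₚ.pos-* (5 ℕ.* Δ) _)))
    (trans (ℤₚ.*-identityʳ _) (trans (cong (+ n *_) (sym (ℤₚ.pos-* p p))) (sym (ℤₚ.pos-* n (p ℕ.* p))))) le′)

-- The hypothesis is the conclusion cross-multiplied, with the negative term moved across so that it
-- can be stated in ℕ.
[1-ε]*M≤N : ∀ {M N p d} .(c : Coprime p (suc d)) → let ε = mkℚ (+ p) d c in
  M ℕ.* suc d ℕ.≤ N ℕ.* suc d ℕ.+ M ℕ.* p → (1ℚ ℚ.- ε) ℚ.* ((+ M) ℚ./ 1) ℚ.≤ (+ N) ℚ./ 1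
[1-ε]*M≤N {M} {N} {p} {d} c le = ℚₚ.toℚᵘ-cancel-≤ (begin
    toℚᵘ ((1ℚ ℚ.- ε) ℚ.* ((+ M) ℚ./ 1))
      ≃⟨ ℚₚ.toℚᵘ-homo-* (1ℚ ℚ.- ε) ((+ M) ℚ./ 1) ⟩
    toℚᵘ (1ℚ ℚ.- ε) ℚᵘ.* toℚᵘ ((+ M) ℚ./ 1)
      ≃⟨ ℚᵘₚ.*-cong (ℚᵘₚ.≃-trans (ℚₚ.toℚᵘ-homo-+ 1ℚ (ℚ.- ε)) (ℚᵘₚ.+-cong {toℚᵘ 1ℚ} ℚᵘₚ.≃-refl (ℚₚ.toℚᵘ-homo‿- ε))) (toℚᵘ-/1 M) ⟩
    (toℚᵘ 1ℚ ℚᵘ.+ ℚᵘ.- toℚᵘ ε) ℚᵘ.* mkℚᵘ (+ M) 0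
      ≤⟨ *≤* cleared ⟩
    mkℚᵘ (+ N) 0
      ≃⟨ toℚᵘ-/1 N ⟨
    toℚᵘ ((+ N) ℚ./ 1) ∎)
  where
  open ℚᵘₚ.≤-Reasoning
  ε = mkℚ (+ p) d c
  q = + suc d
  le′ : + M * q ℤ.≤ + N * q + + M * + p
  le′ = subst₂ ℤ._≤_ (ℤₚ.pos-* M (suc d))
    (trans (ℤₚ.pos-+ (N ℕ.* suc d) (M ℕ.* p)) (cong₂ _+_ (ℤₚ.pos-* N (suc d)) (ℤₚ.pos-* M p))) (+≤+ le)
  lemma : ∀ M p q → M * q - M * p ≡ (+ 1 * q + - p * + 1) * M * + 1
  lemma = solve-∀
  lemma₁ : ∀ x y → x + y - y ≡ x
  lemma₁ = solve-∀
  cleared : (+ 1 * q + - (+ p) * + 1) * + M * + 1 ℤ.≤ + N * + (1 ℕ.* suc d ℕ.* 1)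
  cleared = subst₂ ℤ._≤_ (lemma (+ M) (+ p) q)
    (trans (lemma₁ (+ N * q) (+ M * + p)) (cong (λ k → + N * + k) (sym (trans (ℕₚ.*-identityʳ _) (ℕₚ.*-identityˡ (suc d))))))
    (ℤₚ.+-monoˡ-≤ (- (+ M * + p)) le′)

-- `n<Qs` drives the pigeonhole argument, `room` and `room₀` give later and first fibres their free
-- arcs, and `loss` bounds the cost of an attachment by ε n, where ε = p / q.
record Parameters (Δ n p q : ℕ) : Set where
  field
    Q s   : ℕ
    Q<n   : Q ℕ.< n
    n<Qs  : n ℕ.< Q ℕ.* suc s
    room  : s ℕ.+ Q ℕ.* Δ ℕ.≤ n
    room₀ : suc (Q ℕ.* Δ) ℕ.≤ n
    loss  : (s ℕ.+ Q) ℕ.* q ℕ.≤ n ℕ.* p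

-- With ε = p / q, take Q ≈ 2 / ε and s ≈ n / Q ≈ ε n / 2.
parameters : ∀ Δ n p q .{{_ : NonZero Δ}} .{{_ : NonZero p}} .{{_ : NonZero q}} → p ℕ.* 2 ℕ.≤ q →
             5 ℕ.* Δ ℕ.* (q ℕ.* q) ℕ.≤ n ℕ.* (p ℕ.* p) → Parameters Δ n p q
parameters Δ n p q 2p≤q dense = record
  { Q = Q ; s = s
  ; Q<n = ℕₚ.≤-<-trans (ℕₚ.m≤m*n Q Δ) QΔ<n
  ; n<Qs = subst (n ℕ.<_) (ℕₚ.*-comm (suc s) Q) (m<[1+m/n]*n n Q)
  ; room = ℕₚ.*-cancelʳ-≤ (s ℕ.+ Q ℕ.* Δ) n q (ℕₚ.≤-trans (bound (Q ℕ.* Δ) ℕₚ.≤-refl) (ℕₚ.*-monoʳ-≤ n p≤q))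
  ; room₀ = QΔ<n
  ; loss = bound Q (ℕₚ.m≤m*n Q Δ)
  }
  where
  open ℕₚ.≤-Reasoning
  Q = suc ((2 ℕ.* q) / p)
  s = n / Q
  p≤q : p ℕ.≤ q
  p≤q = ℕₚ.≤-trans (ℕₚ.m≤m*n p 2) 2p≤q

  -- By the choice of `Q`, `Q p ≤ p + 2 q`; then `2 p ≤ q` bounds `2 q Δ (p + 2 q)` by `5 Δ q²`. The
  -- constant 5 and the bound ε ≤ 1/2 enter here.
  2qQΔ≤np : 2 ℕ.* q ℕ.* (Q ℕ.* Δ) ℕ.≤ n ℕ.* p
  2qQΔ≤np = ℕₚ.*-cancelʳ-≤ _ _ p (begin
    2 ℕ.* q ℕ.* (Q ℕ.* Δ) ℕ.* p                   ≡⟨ lemma₁ q Q Δ p ⟩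
    2 ℕ.* q ℕ.* Δ ℕ.* (Q ℕ.* p)                   ≤⟨ ℕₚ.*-monoʳ-≤ (2 ℕ.* q ℕ.* Δ) (ℕₚ.+-monoʳ-≤ p (m/n*n≤m (2 ℕ.* q) p)) ⟩
    2 ℕ.* q ℕ.* Δ ℕ.* (p ℕ.+ 2 ℕ.* q)             ≡⟨ lemma₂ q Δ p ⟩
    q ℕ.* Δ ℕ.* (p ℕ.* 2 ℕ.+ 4 ℕ.* q)             ≤⟨ ℕₚ.*-monoʳ-≤ (q ℕ.* Δ) (ℕₚ.+-monoˡ-≤ (4 ℕ.* q) 2p≤q) ⟩
    q ℕ.* Δ ℕ.* (q ℕ.+ 4 ℕ.* q)                   ≡⟨ lemma₃ q Δ ⟩
    5 ℕ.* Δ ℕ.* (q ℕ.* q)                         ≤⟨ dense ⟩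
    n ℕ.* (p ℕ.* p)                               ≡⟨ ℕₚ.*-assoc n p p ⟨
    n ℕ.* p ℕ.* p                                 ∎)
    where
    lemma₁ : ∀ q Q Δ p → 2 ℕ.* q ℕ.* (Q ℕ.* Δ) ℕ.* p ≡ 2 ℕ.* q ℕ.* Δ ℕ.* (Q ℕ.* p)
    lemma₁ = ℕ-solve-∀
    lemma₂ : ∀ q Δ p → 2 ℕ.* q ℕ.* Δ ℕ.* (p ℕ.+ 2 ℕ.* q) ≡ q ℕ.* Δ ℕ.* (p ℕ.* 2 ℕ.+ 4 ℕ.* q)
    lemma₂ = ℕ-solve-∀
    lemma₃ : ∀ q Δ → q ℕ.* Δ ℕ.* (q ℕ.+ 4 ℕ.* q) ≡ 5 ℕ.* Δ ℕ.* (q ℕ.* q)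
    lemma₃ = ℕ-solve-∀

  -- From `Q > 2 q / p` and `s Q ≤ n` follows `s ≤ ε n / 2`.
  2qs≤np : 2 ℕ.* q ℕ.* s ℕ.≤ n ℕ.* p
  2qs≤np = begin
    2 ℕ.* q ℕ.* s   ≤⟨ ℕₚ.*-monoˡ-≤ s (ℕₚ.<⇒≤ (m<[1+m/n]*n (2 ℕ.* q) p)) ⟩
    Q ℕ.* p ℕ.* s   ≡⟨ lemma Q p s ⟩
    s ℕ.* Q ℕ.* p   ≤⟨ ℕₚ.*-monoˡ-≤ p (m/n*n≤m n Q) ⟩
    n ℕ.* p         ∎
    where
    lemma : ∀ Q p s → Q ℕ.* p ℕ.* s ≡ s ℕ.* Q ℕ.* p
    lemma = ℕ-solve-∀

  -- Both summands are at most ε n / 2. Taking `x = Q` gives `loss`, and `x = Q Δ` gives `room`.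
  bound : ∀ x → x ℕ.≤ Q ℕ.* Δ → (s ℕ.+ x) ℕ.* q ℕ.≤ n ℕ.* p
  bound x x≤ = ℕₚ.*-cancelˡ-≤ 2 (begin
    2 ℕ.* ((s ℕ.+ x) ℕ.* q)                       ≡⟨ lemma₁ s x q ⟩
    2 ℕ.* q ℕ.* s ℕ.+ 2 ℕ.* q ℕ.* x               ≤⟨ ℕₚ.+-mono-≤ 2qs≤np (ℕₚ.≤-trans (ℕₚ.*-monoʳ-≤ (2 ℕ.* q) x≤) 2qQΔ≤np) ⟩
    n ℕ.* p ℕ.+ n ℕ.* p                           ≡⟨ lemma₂ (n ℕ.* p) ⟩
    2 ℕ.* (n ℕ.* p)                               ∎)
    where
    lemma₁ : ∀ s x q → 2 ℕ.* ((s ℕ.+ x) ℕ.* q) ≡ 2 ℕ.* q ℕ.* s ℕ.+ 2 ℕ.* q ℕ.* x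
    lemma₁ = ℕ-solve-∀
    lemma₂ : ∀ x → x ℕ.+ x ≡ 2 ℕ.* x
    lemma₂ = ℕ-solve-∀

  4QΔ≤n : 4 ℕ.* (Q ℕ.* Δ) ℕ.≤ n
  4QΔ≤n = ℕₚ.*-cancelʳ-≤ _ n q (begin
    4 ℕ.* (Q ℕ.* Δ) ℕ.* q          ≡⟨ lemma (Q ℕ.* Δ) q ⟩
    2 ℕ.* q ℕ.* (Q ℕ.* Δ) ℕ.* 2    ≤⟨ ℕₚ.*-monoˡ-≤ 2 2qQΔ≤np ⟩
    n ℕ.* p ℕ.* 2                  ≡⟨ ℕₚ.*-assoc n p 2 ⟩
    n ℕ.* (p ℕ.* 2)                ≤⟨ ℕₚ.*-monoʳ-≤ n 2p≤q ⟩
    n ℕ.* q                        ∎)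
    where
    lemma : ∀ x q → 4 ℕ.* x ℕ.* q ≡ 2 ℕ.* q ℕ.* x ℕ.* 2
    lemma = ℕ-solve-∀

  QΔ<n : Q ℕ.* Δ ℕ.< n
  QΔ<n = ℕₚ.<-≤-trans (ℕₚ.m<m+n (Q ℕ.* Δ) (ℕₚ.≤-trans (ℕ.>-nonZero⁻¹ _ {{ℕₚ.m*n≢0 Q Δ}}) (ℕₚ.m≤m+n _ _))) 4QΔ≤n

-- Assembly over the whole tree.

length-bound : ∀ {j n D p q l} → D ℕ.* q ℕ.≤ n ℕ.* p → suc j ℕ.* n ℕ.≤ l ℕ.+ j ℕ.* D →
               suc j ℕ.* n ℕ.* q ℕ.≤ l ℕ.* q ℕ.+ suc j ℕ.* n ℕ.* p
length-bound {j} {n} {D} {p} {q} {l} loss long = begin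
  suc j ℕ.* n ℕ.* q                 ≤⟨ ℕₚ.*-monoˡ-≤ q long ⟩
  (l ℕ.+ j ℕ.* D) ℕ.* q             ≡⟨ lemma l j D q ⟩
  -- The cost of `j` attachments is enlarged to that of `j + 1`, making it ε times the number of
  -- vertices of the lift.
  l ℕ.* q ℕ.+ j ℕ.* (D ℕ.* q)       ≤⟨ ℕₚ.+-monoʳ-≤ (l ℕ.* q) (ℕₚ.*-mono-≤ (ℕₚ.n≤1+n j) loss) ⟩
  l ℕ.* q ℕ.+ suc j ℕ.* (n ℕ.* p)   ≡⟨ cong (l ℕ.* q ℕ.+_) (ℕₚ.*-assoc (suc j) n p) ⟨
  l ℕ.* q ℕ.+ suc j ℕ.* n ℕ.* p     ∎
  where
  open ℕₚ.≤-Reasoning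
  lemma : ∀ l j D q → (l ℕ.+ j ℕ.* D) ℕ.* q ≡ l ℕ.* q ℕ.+ j ℕ.* (D ℕ.* q)
  lemma = ℕ-solve-∀

-- The first edge of the walk gives `zero` a neighbour. A positive Δ is what `parameters` asks for.
connected⇒1≤Δ : ∀ {m Δ} (adj : Fin (suc (suc m)) → Fin (suc (suc m)) → Bool) →
                Star (SimpleAdj _ adj) zero (suc zero) → MaxDegreeAtMost _ adj Δ → 1 ℕ.≤ Δ
connected⇒1≤Δ adj (_◅_ {j = v} 0v _) deg = ℕₚ.≤-trans
  (∈-length (∈-filter⁺ (T? ∘ adj zero) (∈-allFin v) (Equivalence.from T-≡ 0v))) (deg zero)

graph-cycle : ∀ {Δ n m p q} .{{_ : NonZero n}} .{{_ : NonZero p}} .{{_ : NonZero q}} →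
  p ℕ.* 2 ℕ.≤ q → 5 ℕ.* Δ ℕ.* (q ℕ.* q) ℕ.≤ n ℕ.* (p ℕ.* p) →
  (adj : Fin (suc m) → Fin (suc m) → Bool) → (∀ u v → adj u v ≡ adj v u) →
  (∀ u v → Star (SimpleAdj (suc m) adj) u v) → MaxDegreeAtMost (suc m) adj Δ →
  (σ : Fin (suc m) → Fin (suc m) → ℤ) → IsVoltage (suc m) n adj σ →
  (ℓ : Fin (suc m) → ℤ) → (∀ u → Coprime ∣ ℓ u ∣ n) →
  Σ ℕ λ k → Σ (Fin (suc k) → Fin (suc m) × Fin n) λ c →
  IsCycle (LiftAdj (suc m) n adj σ ℓ) k c × suc m ℕ.* n ℕ.* q ℕ.≤ suc k ℕ.* q ℕ.+ suc m ℕ.* n ℕ.* p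
-- With one vertex Δ may be 0, outside the reach of `parameters`; the single fibre is already a
-- cycle through the whole lift, so `Q = s = 0` suffices.
graph-cycle {n = n} {zero} {p} {q} _ _ adj adj-sym _ _ σ volt ℓ cop =
  let k , c , cycle , long = state⇒cycle start in
  k , c , cycle , length-bound {0} {n} {0} {p} {q} {suc k} z≤n long
  where
  open Growth 1 n adj adj-sym σ volt ℓ cop 0 0
  start : State 0 []
  start = initial zero [] (λ ()) (λ { zero _ → refl }) (ℕ.>-nonZero⁻¹ n)
graph-cycle {Δ} {n} {suc m} {p} {q} 2p≤q dense adj adj-sym connected deg σ volt ℓ cop =
  let k , c , cycle , long = state⇒cycle final in
  k , c , cycle , length-bound {suc m} {n} {s ℕ.+ Q} {p} {q} {suc k} loss long
  where
  open Parameters (parameters Δ n p q {{ℕ.>-nonZero (connected⇒1≤Δ adj (connected zero (suc zero)) deg)}} 2p≤q dense)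
  open Growth (suc (suc m)) n adj adj-sym σ volt ℓ cop Q s
  -- By computation `zero ∷ U` is the list of all vertices, so the degree bound and uniqueness pass
  -- to `U`.
  U : List (Fin (suc (suc m)))
  U = tabulate suc

  deg′ : ∀ u → unvisited U u ℕ.≤ Δ
  deg′ u = ℕₚ.≤-trans (unvisited-∷ u zero U) (deg u)

  0∉U : zero ∉ U
  0∉U 0∈U with allFin⁺ (suc (suc m))
  ... | 0≢ ∷ _ = All.lookup 0≢ 0∈U refl

  start : State 0 U
  start = initial zero U 0∉U (λ { zero _ → refl ; (suc u) u∉U → contradiction (∈-tabulate⁺ {f = suc} u) u∉U })
    (ℕₚ.≤-trans (s≤s (ℕₚ.*-monoʳ-≤ Q (deg′ zero))) room₀)

  final : State (suc m) []
  final = subst (λ j → State j []) (ℕₚ.+-identityʳ (suc m))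
    (grow Q<n n<Qs room (suc m) U (length-tabulate {n = suc m} suc)
      (unique-++⁻ʳ [ zero ] (allFin⁺ (suc (suc m)))) 0∉U connected deg′ start)

theorem6 : (Δ : ℕ) (ε : ℚ) (n m : ℕ) .{{_ : NonZero n}} →
    0ℚ ℚ.< ε → ε ℚ.≤ ½ → (ℤ.+ (5 ℕ.* Δ)) ℚ./ 1 ℚ.≤ ((ℤ.+ n) ℚ./ 1) ℚ.* (ε ℚ.* ε) →
    (adj : Fin m → Fin m → Bool) → IsTree m adj → MaxDegreeAtMost m adj Δ →
    (σ : Fin m → Fin m → ℤ) → IsVoltage m n adj σ →
    (ℓ : Fin m → ℤ) → (∀ u → Coprime ∣ ℓ u ∣ n) →
    Σ ℕ λ k → Σ (Fin (suc k) → Fin m × Fin n) λ c →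
    IsCycle (LiftAdj m n adj σ ℓ) k c ×
    (1ℚ ℚ.- ε) ℚ.* ((ℤ.+ (m ℕ.* n)) ℚ./ 1) ℚ.≤ ((ℤ.+ (suc k)) ℚ./ 1)
theorem6 Δ (mkℚ -[1+ _ ] _ _) n m (ℚ.*<* ())
theorem6 Δ (mkℚ (+ 0) _ _)    n m (ℚ.*<* (+<+ ()))
theorem6 Δ (mkℚ +[1+ _ ] _ _) n zero _ _ _ _ (() , _)
theorem6 Δ (mkℚ +[1+ a ] d coprime) n (suc m) _ (ℚ.*≤* 2p≤q) dense adj
    (_ , (adj-sym , _) , connected , _) deg σ volt ℓ ℓ-coprime =
  let k , c , cycle , long = graph-cycle {p = suc a} {suc d}
        (subst (suc a ℕ.* 2 ℕ.≤_) (ℕₚ.*-identityˡ (suc d)) (ℤₚ.drop‿+≤+ 2p≤q))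
        (5Δ≤nε²-clear {Δ} {n} coprime dense) adj adj-sym connected deg σ volt ℓ ℓ-coprime
  in k , c , cycle , [1-ε]*M≤N {suc m ℕ.* n} {suc k} coprime long
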